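{- Let $k \geq 3$, $q \geq 1$, $t\geq 1$ and $v_1, v_2, \dots, v_{t-1}$ be integers such that there exist Steiner systems $H_i = S(2,k,v_i)$ for all $1 \leq i \leq t-1$. Denoting $n_i = \frac{v_i - 1}{k-1}$, assume that $n_1 = qk$ and $n_j = qk\prod_{i=1}^{j-1} v_i$ holds for all $2 \leq j \leq t-1$. Recursively define $$S_1(k) = qK_k, \qquad S_{i+1}(k) = \Gamma(S_i(k), H_i)$$ for $i = 1, \dots, t-1$. Then $S_t(k)$ is a graph of order $n_t = kq\prod_{i=1}^{t-1} v_i$ and constant link $tK_{k-1}$.
   Context: All graphs are finite and simple; order means number of vertices. A graph $G$ has constant link $L$ if for every vertex $v$ the subgraph induced by the open neighborhood $N(v)$ is isomorphic to $L$; $tL$ is the disjoint union of $t$ copies of $L$. A Steiner system $S(2,k,v)$ is a pair $(V,B)$ where $V$ is a set of $v$ points and $B$ is a family of $k$-element subsets of $V$ (blocks) such that each $2$-element subset of $V$ is contained in exactly one block. It is regarded as a $k$-uniform $\frac{v-1}{k-1}$-regular hypergraph with vertex set $V$ and edge set $B$. Construction of $\Gamma(G,H)$ (with the clique $K_k$): let $G$ be a graph of order $n$ and constant link $sK_{k-1}$ for some $s\ge1$, and $H$ an $n$-regular $k$-uniform hypergraph (every vertex in exactly $n$ edges, every edge of size $k$) with vertices $x_1,\dots,x_N$. (1) At each vertex $x$ of $H$ enumerate the hyperedges containing $x$ as $E_{x,1},\dots,E_{x,n}$. (2) Take $N$ disjoint copies of $G$ on vertex sets $V_1,\dots,V_N$,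 $V_i=\{v_{i,1},\dots,v_{i,n}\}$, and set $V(\Gamma)=V_1\cup\dots\cup V_N$. (3) With each edge $E$ of $H$ associate the $k$-element set $f(E)\subseteq V(\Gamma)$ defined by $v_{i,j}\in f(E)$ if and only if $E_{x_i,j}=E$. (4) For each hyperedge $E$ of $H$, place a copy of $K_k$ on the set $f(E)$. The resulting graph (for any choice of the enumerations) is $\Gamma(G,H)$. -}

module Defs where

open import Level using (0ℓ)
open import Data.Nat using (ℕ; zero; suc; _*_; _∸_; _≤_; _<_)
open import Data.Fin using (Fin)
import Data.Fin.Properties as Fin
open import Data.Fin.Subset using (Subset; _∈_; ∣_∣)
open import Data.Product using (∃; ∃!; _×_; _,_; proj₁; proj₂)
open import Data.Product.Properties using (≡-dec)
open import Data.Product.Function.NonDependent.Propositional using (_×-↔_)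
open import Data.Sum using (_⊎_; inj₁; inj₂)
open import Data.Refinement using (Refinement; value)
open import Function using (Injective)
open import Function.Bundles using (_↔_; _⇔_; Inverse)
open import Function.Construct.Composition using (_↔-∘_)
open import Function.Construct.Identity using (↔-id)
open import Function.Construct.Symmetry using (↔-sym)
open import Function.Properties.Inverse using (↔⇒↣)
open import Relation.Nullary.Decidable using (¬?; _×-dec_; _⊎-dec_; via-injection)
open import Relation.Binary using (Rel; Decidable; DecidableEquality; Symmetric; Irreflexive)
open import Relation.Binary.PropositionalEquality using (_≡_; _≢_; refl; sym; ≢-sym)

record Graph : Set₁ where
  field
    V      : Set
    Adj    : Rel V 0ℓ
    symm   : Symmetric Adj
    irrefl : Irreflexive _≡_ Adj
    adj?   : Decidable Adj

-- Adj need not be proof-irrelevant, so only "Adj u w holds" is compared,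
-- not its proofs.
record _≅_ (G H : Graph) : Set where
  private
    module G = Graph G
    module H = Graph H
  field
    bijection : G.V ↔ H.V
    preserves : ∀ u w → G.Adj u w ⇔ H.Adj (Inverse.to bijection u) (Inverse.to bijection w)

infix 4 _≅_

-- A refinement rather than a Σ-type: each vertex satisfying P occurs once,
-- however many proofs of P it has.
induced : (G : Graph) → (Graph.V G → Set) → Graph
induced G P = record
  { V      = Refinement V P
  ; Adj    = λ a b → Adj (value a) (value b)
  ; symm   = symm
  ; irrefl = λ { refl → irrefl refl }
  ; adj?   = λ a b → adj? (value a) (value b)
  }
  where open Graph G

link : (G : Graph) → Graph.V G → Graph
link G v = induced G (Graph.Adj G v)

record FiniteGraph : Set₁ where
  field
    graph     : Graph
    order     : ℕ
    labelling : Graph.V graph ↔ Fin order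

  open Graph graph public

  label : V → Fin order
  label = Inverse.to labelling

  _≟V_ : DecidableEquality V
  _≟V_ = via-injection (↔⇒↣ labelling) Fin._≟_

ConstantLink : FiniteGraph → FiniteGraph → Set
ConstantLink G L = ∀ v → link (FiniteGraph.graph G) v ≅ FiniteGraph.graph L

K : ℕ → FiniteGraph
K n = record
  { graph = record
    { V      = Fin n
    ; Adj    = _≢_
    ; symm   = ≢-sym
    ; irrefl = λ eq neq → neq eq
    ; adj?   = λ i j → ¬? (i Fin.≟ j)
    }
  ; order     = n
  ; labelling = ↔-id (Fin n)
  }

-- t · L is the disjoint union of t copies of L.
infixr 7 _·_

_·_ : ℕ → FiniteGraph → FiniteGraph
t · L = record
  { graph = record
    { V      = Fin t × V
    ; Adj    = λ { (i , u) (j , w) → i ≡ j × Adj u w }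
    ; symm   = λ { (eq , a) → sym eq , symm a }
    ; irrefl = λ { refl (_ , a) → irrefl refl a }
    ; adj?   = λ { (i , u) (j , w) → (i Fin.≟ j) ×-dec adj? u w }
    }
  ; order     = t * order
  ; labelling = ↔-sym Fin.*↔× ↔-∘ (↔-id (Fin t) ×-↔ labelling)
  }
  where open FiniteGraph L

-- k-uniform hypergraphs with vertex set Fin N. The edge set is a set of
-- subsets, presented as an injective finite family.
record Hypergraph (k N : ℕ) : Set where
  field
    size     : ℕ
    edge     : Fin size → Subset N
    distinct : Injective _≡_ _≡_ edge
    uniform  : ∀ e → ∣ edge e ∣ ≡ k

  Edge : Set
  Edge = Fin size

record SteinerSystem (k v : ℕ) : Set where
  field
    hypergraph : Hypergraph k v

  open Hypergraph hypergraph public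

  field
    pairs : ∀ x y → x ≢ y → ∃! _≡_ λ e → x ∈ edge e × y ∈ edge e

-- A choice, at every vertex x, of an enumeration E_{x,1}, …, E_{x,n} of the
-- edges containing x. Such a choice exists exactly when H is n-regular.
Enumeration : ∀ {k N} → Hypergraph k N → ℕ → Set
Enumeration {N = N} H n = (x : Fin N) → Fin n ↔ (∃ λ e → x ∈ edge e)
  where open Hypergraph H

-- The vertex (x , u) is the copy of u in the copy of G attached to x; it plays
-- the role of v_{i,j} with x = x_i and j = label u. Using one labelling of G
-- for all copies loses nothing, as the enumeration at each x is arbitrary.
module _ {k N : ℕ} (G : FiniteGraph) (H : Hypergraph k N)
         (ε : Enumeration H (FiniteGraph.order G)) where

  open FiniteGraph G
  open Hypergraph H using (Edge)

  f : Edge → Fin N × V → Set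
  f e (x , u) = proj₁ (Inverse.to (ε x) (label u)) ≡ e

  CopyAdj CliqueAdj : Rel (Fin N × V) 0ℓ
  CopyAdj (x , u) (y , w) = x ≡ y × Adj u w
  CliqueAdj a b = a ≢ b × ∃ λ e → f e a × f e b

  Γ : FiniteGraph
  Γ = record
    { graph = record
      { V      = Fin N × V
      ; Adj    = λ a b → CopyAdj a b ⊎ CliqueAdj a b
      ; symm   = λ { (inj₁ (eq , a))          → inj₁ (sym eq , symm a)
                   ; (inj₂ (neq , e , p , q)) → inj₂ (≢-sym neq , e , q , p) }
      ; irrefl = λ { refl (inj₁ (_ , a))   → irrefl refl a
                   ; refl (inj₂ (neq , _)) → neq refl }
      ; adj?   = λ { a@(x , u) b@(y , w) →
                     ((x Fin.≟ y) ×-dec adj? u w)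
                     ⊎-dec
                     (¬? (≡-dec Fin._≟_ _≟V_ a b)
                      ×-dec Fin.any? λ e → (_ Fin.≟ e) ×-dec (_ Fin.≟ e)) }
      }
    ; order     = N * order
    ; labelling = ↔-sym Fin.*↔× ↔-∘ (↔-id (Fin N) ×-↔ labelling)
    }

-- ∏ m v is v 1 * v 2 * … * v m.
∏ : ℕ → (ℕ → ℕ) → ℕ
∏ zero    v = 1
∏ (suc m) v = ∏ m v * v (suc m)

-- IsS q H i G says that G is one of the graphs S_i(k). The recursion is a
-- relation because Γ depends on the choice of enumerations, and because
-- Γ(S_i, H_i) is formed only when H_i is regular of degree the order of S_i.
data IsS {k t : ℕ} {v : ℕ → ℕ} (q : ℕ)
         (H : ∀ i → 1 ≤ i → i < t → SteinerSystem k (v i)) : ℕ → FiniteGraph → Set₁ where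
  first : IsS q H 1 (q · K k)
  next  : ∀ {i G} (1≤i : 1 ≤ i) (i<t : i < t) → IsS q H i G →
          (ε : Enumeration (SteinerSystem.hypergraph (H i 1≤i i<t)) (FiniteGraph.order G)) →
          IsS q H (suc i) (Γ G (SteinerSystem.hypergraph (H i 1≤i i<t)) ε)

{-# OPTIONS --safe #-}
-- In Γ(G, H) a vertex u of the copy of G at x lies in exactly one clique f(e), and that clique has
-- one vertex in the copy at each point of e. So the link of (x , u) consists of a K_{k-1} inside
-- f(e) and the link of u in G. There is no adjacency between the two parts: an edge from (x , w)
-- to the copy at y ∈ e, y ≠ x, lies in some f(e'), and e' = e since x and y determine their
-- block, which forces w = u. Each step thus adds one copy of K_{k-1} to the links.
--
-- The recursion never gets stuck: double counting the points other than x shows that every point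
-- of S(2,k,v) lies on (v - 1) / (k - 1) blocks, and n_i is the order of S_i.
module Submission where

open import Defs
open import Data.Nat using (ℕ; NonZero; zero; suc; _+_; _*_; _∸_; _≤_; _<_; s≤s; z≤n)
open import Data.Nat.Properties using (*-comm; *-assoc; *-identityʳ; *-cancelʳ-≡; <⇒≤; ≤-refl)
open import Data.Fin using (Fin; zero; suc; punchIn; punchOut)
open import Data.Fin.Properties as Fin
  using (punchIn-injective; punchInᵢ≢i; punchIn-punchOut; punchOut-punchIn; punchOut-cong)
open import Data.Fin.Permutation using (↔⇒≡)
open import Data.Fin.Subset using (Subset; _∈_; ∣_∣; inside; outside)
open import Data.Empty using (⊥)
open import Data.Irrelevant using ([_])
open import Data.Product using (∃; _×_; _,_; proj₁; proj₂)
open import Data.Product.Function.Dependent.Propositional using (Σ-↔)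
open import Data.Refinement using (value; _,_)
open import Data.Refinement.Properties using (value-injective)
open import Data.Sum using (_⊎_; inj₁; inj₂; [_,_]′)
open import Data.Sum.Function.Propositional using (_⊎-↔_)
open import Data.Vec using ([]; _∷_; lookup; tabulate; here; there)
open import Data.Vec.Properties using ([]=⇒lookup; lookup⇒[]=; lookup∘tabulate)
open import Data.Vec.Properties.WithK using ([]=-irrelevant)
open import Function using (_∘_; Injective; StrictlySurjective)
open import Function.Bundles using (_↔_; _⇔_; Inverse; Injection; mk↔ₛ′; mk⇔; mk⤖)
open import Function.Consequences.Propositional using (strictlySurjective⇒surjective)
open import Function.Construct.Composition using (_↔-∘_; _⇔-∘_)
open import Function.Construct.Identity using (↔-id; ⇔-id)
open import Function.Construct.Symmetry using (↔-sym; ⇔-sym)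
open import Function.Properties.Bijection using (⤖⇒↔)
open import Function.Properties.Inverse using (↔⇒↣)
open import Relation.Nullary using (¬_; no; contradiction)
open import Relation.Nullary.Decidable using (recompute)
open import Relation.Binary.PropositionalEquality
  using (_≡_; _≢_; refl; sym; trans; cong; subst; subst₂; module ≡-Reasoning)

private variable
  A B : Set

-- Bijections and the counting of finite subsets.

bijective⇒↔ : {f : A → B} → Injective _≡_ _≡_ f → StrictlySurjective _≡_ f → A ↔ B
bijective⇒↔ inj surj = ⤖⇒↔ (mk⤖ (inj , strictlySurjective⇒surjective surj))

to-injective : (φ : A ↔ B) → Injective _≡_ _≡_ (Inverse.to φ)
to-injective φ = Injection.injective (↔⇒↣ φ)

-- Negations are definitionally proof-irrelevant, so Σ-types over ≢ are subsets.
Others : A → Set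
Others a = ∃ λ b → a ≢ b

others↔Fin : ∀ {m} → A ↔ Fin (suc m) → (a : A) → Others a ↔ Fin m
others↔Fin {A} {m} φ a = mk↔ₛ′ split join split-join join-split
  where
  open Inverse φ

  split : Others a → Fin m
  split (b , a≢b) = punchOut {i = to a} {to b} (a≢b ∘ to-injective φ)

  join : Fin m → Others a
  join j = from (punchIn (to a) j) ,
    λ eq → punchInᵢ≢i (to a) j (trans (sym (strictlyInverseˡ _)) (cong to (sym eq)))

  split-join : ∀ j → split (join j) ≡ j
  split-join j = trans (punchOut-cong (to a) (strictlyInverseˡ _)) (punchOut-punchIn (to a))

  others-≡ : {b c : Others a} → proj₁ b ≡ proj₁ c → b ≡ c
  others-≡ refl = refl

  join-split : ∀ b → join (split b) ≡ b
  join-split (b , a≢b) =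
    others-≡ (trans (cong from (punchIn-punchOut (a≢b ∘ to-injective φ))) (strictlyInverseʳ b))

Members : ∀ {n} → Subset n → Set
Members p = ∃ λ x → x ∈ p

members-≡ : ∀ {n} {p : Subset n} {a b : Members p} → proj₁ a ≡ proj₁ b → a ≡ b
members-≡ {a = x , x∈p} {.x , x∈p′} refl = cong (x ,_) ([]=-irrelevant x∈p x∈p′)

-- Turns the cardinality of a subset into a bijection, so that the later double counting is a
-- composition of bijections.
members↔Fin : ∀ {n} (p : Subset n) → Members p ↔ Fin ∣ p ∣
members↔Fin [] = mk↔ₛ′ (λ ()) (λ ()) (λ ()) (λ ())
members↔Fin (outside ∷ p) = members↔Fin p ↔-∘ mk↔ₛ′ tail shift (λ _ → refl) shift-tail
  where
  tail : Members (outside ∷ p) → Members p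
  tail (suc x , there x∈p) = x , x∈p

  shift : Members p → Members (outside ∷ p)
  shift (x , x∈p) = suc x , there x∈p

  shift-tail : ∀ a → shift (tail a) ≡ a
  shift-tail (suc _ , there _) = refl
members↔Fin (inside ∷ p) = mk↔ₛ′ index member index-member member-index
  where
  open Inverse (members↔Fin p)

  index : Members (inside ∷ p) → Fin (suc ∣ p ∣)
  index (zero  , here)      = zero
  index (suc x , there x∈p) = suc (to (x , x∈p))

  member : Fin (suc ∣ p ∣) → Members (inside ∷ p)
  member zero    = zero , here
  member (suc j) = suc (proj₁ (from j)) , there (proj₂ (from j))

  index-member : ∀ j → index (member j) ≡ j
  index-member zero    = refl
  index-member (suc j) = cong suc (strictlyInverseˡ j)

  member-index : ∀ a → member (index a) ≡ a
  member-index (zero  , here)      = refl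
  member-index (suc x , there x∈p) = members-≡ (cong (suc ∘ proj₁) (strictlyInverseʳ (x , x∈p)))

-- Graph isomorphisms, disjoint unions and the links of `q · K k`.

≅-sym : ∀ {G H} → G ≅ H → H ≅ G
≅-sym {H = H} iso = record
  { bijection = ↔-sym bijection
  ; preserves = λ u w → ⇔-sym (subst₂ (λ u′ w′ → _ ⇔ Graph.Adj H u′ w′)
      (strictlyInverseˡ u) (strictlyInverseˡ w) (preserves (from u) (from w)))
  }
  where open _≅_ iso
        open Inverse bijection

≅-trans : ∀ {G H I} → G ≅ H → H ≅ I → G ≅ I
≅-trans iso iso′ = record
  { bijection = _≅_.bijection iso′ ↔-∘ _≅_.bijection iso
  ; preserves = λ u w → _≅_.preserves iso′ _ _ ⇔-∘ _≅_.preserves iso u w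
  }

infixr 6 _⊕_

-- Complements `_·_`, whose summands are copies of one graph: a link in `Γ` first appears as a
-- clique beside a link of `G`, and `suc-·-≅` then turns such a sum into a multiple of `K m`.
_⊕_ : Graph → Graph → Graph
G ⊕ H = record
  { V      = G.V ⊎ H.V
  ; Adj    = Adj
  ; symm   = λ { {inj₁ _} {inj₁ _} → G.symm ; {inj₂ _} {inj₂ _} → H.symm }
  ; irrefl = λ { {inj₁ _} refl → G.irrefl refl ; {inj₂ _} refl → H.irrefl refl }
  ; adj?   = λ { (inj₁ u) (inj₁ w) → G.adj? u w ; (inj₂ u) (inj₂ w) → H.adj? u w
               ; (inj₁ _) (inj₂ _) → no λ () ; (inj₂ _) (inj₁ _) → no λ () }
  }
  where
  module G = Graph G
  module H = Graph H
  Adj : G.V ⊎ H.V → G.V ⊎ H.V → Set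
  Adj (inj₁ u) (inj₁ w) = G.Adj u w
  Adj (inj₂ u) (inj₂ w) = H.Adj u w
  Adj (inj₁ _) (inj₂ _) = ⊥
  Adj (inj₂ _) (inj₁ _) = ⊥

⊕-congˡ : ∀ {G H I} → H ≅ I → G ⊕ H ≅ G ⊕ I
⊕-congˡ iso = record
  { bijection = ↔-id _ ⊎-↔ bijection
  ; preserves = λ { (inj₁ _) (inj₁ _) → ⇔-id _ ; (inj₂ u) (inj₂ w) → preserves u w
                  ; (inj₁ _) (inj₂ _) → ⇔-id _ ; (inj₂ _) (inj₁ _) → ⇔-id _ }
  }
  where open _≅_ iso

suc-·-≅ : ∀ s L → FiniteGraph.graph (suc s · L) ≅ FiniteGraph.graph L ⊕ FiniteGraph.graph (s · L)
suc-·-≅ s L = record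
  { bijection = mk↔ₛ′
      (λ { (zero , u) → inj₁ u ; (suc i , u) → inj₂ (i , u) })
      [ (zero ,_) , (λ { (i , u) → suc i , u }) ]′
      (λ { (inj₁ _) → refl ; (inj₂ _) → refl })
      (λ { (zero , _) → refl ; (suc _ , _) → refl })
  ; preserves = λ
      { (zero , _)  (zero , _)  → mk⇔ proj₂ (refl ,_)
      ; (suc _ , _) (suc _ , _) → mk⇔ (λ { (refl , a) → refl , a }) (λ { (refl , a) → refl , a })
      ; (zero , _)  (suc _ , _) → mk⇔ (λ ()) (λ ())
      ; (suc _ , _) (zero , _)  → mk⇔ (λ ()) (λ ()) }
  }

-- The neighbours of `(i , a)` are the other vertices of the same clique, and `punchIn a` enumerates
-- these. The factor `1 ·` makes this the base case of the induction on the number of copies.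
link-qK : ∀ q m → ConstantLink (q · K (suc m)) (1 · K m)
link-qK q m (i , a) = ≅-sym (record
  { bijection = bijective⇒↔ {f = h} h-injective h-surjective
  ; preserves = λ { (zero , j) (zero , l) → mk⇔
      (λ { (_ , j≢l) → refl , λ eq → j≢l (punchIn-injective a j l eq) })
      (λ { (_ , ≢) → refl , λ { refl → ≢ refl } }) }
  })
  where
  G = FiniteGraph.graph (q · K (suc m))

  h : Fin 1 × Fin m → Graph.V (link G (i , a))
  h (zero , j) = (i , punchIn a j) , [ (refl , punchInᵢ≢i a j ∘ sym) ]

  h-injective : Injective _≡_ _≡_ h
  h-injective {zero , j} {zero , l} eq =
    cong (zero ,_) (punchIn-injective a j l (cong (proj₂ ∘ value) eq))

  h-surjective : StrictlySurjective _≡_ h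
  -- A vertex of a link carries its adjacency proof irrelevantly; decidability of adjacency gives
  -- back a proof that can be matched on.
  h-surjective (w , [ p ]) with recompute (Graph.adj? G (i , a) w) p
  ... | refl , a≢b = (zero , punchOut a≢b) , value-injective (cong (i ,_) (punchIn-punchOut a≢b))

-- Blocks of a Steiner system through a point.

module _ {m N : ℕ} (S : SteinerSystem (suc m) N) where

  open SteinerSystem S

  block-unique : ∀ {x y e e′} → x ≢ y → x ∈ edge e → y ∈ edge e → x ∈ edge e′ → y ∈ edge e′ → e ≡ e′
  block-unique x≢y x∈e y∈e x∈e′ y∈e′ with pairs _ _ x≢y
  ... | _ , _ , unique = trans (sym (unique (x∈e , y∈e))) (unique (x∈e′ , y∈e′))

  Pencil : Fin N → Set
  Pencil x = ∃ λ e → x ∈ edge e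

  pencil-≡ : ∀ {x} {a b : Pencil x} → proj₁ a ≡ proj₁ b → a ≡ b
  pencil-≡ {a = e , x∈e} {.e , x∈e′} refl = cong (e ,_) ([]=-irrelevant x∈e x∈e′)

  Partners : ∀ {x} → Pencil x → Set
  Partners {x} (e , x∈e) = Others {A = Members (edge e)} (x , x∈e)

  partners↔Fin : ∀ {x} (a : Pencil x) → Partners a ↔ Fin m
  partners↔Fin (e , x∈e) =
    others↔Fin (subst (λ n → Members (edge e) ↔ Fin n) (uniform e) (members↔Fin (edge e))) (_ , x∈e)

  partner-≢ : ∀ {x} {a : Pencil x} ((b , _) : Partners a) → x ≢ proj₁ b
  partner-≢ (_ , ≢b) x≡y = ≢b (members-≡ x≡y)

  partners-≡ : ∀ {x} {a : Pencil x} {b c : Partners a} → proj₁ (proj₁ b) ≡ proj₁ (proj₁ c) → b ≡ c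
  partners-≡ {b = b , ≢b} {c , _} eq with members-≡ {a = b} {c} eq
  ... | refl = refl

  -- For `y` different from `x`, existence of a block through both gives surjectivity, and its
  -- uniqueness gives injectivity.
  flags↔others : ∀ x → (∃ λ (a : Pencil x) → Partners a) ↔ Others x
  flags↔others x = bijective⇒↔ {f = point} inj surj
    where
    point : (∃ λ (a : Pencil x) → Partners a) → Others x
    point (a , b) = proj₁ (proj₁ b) , partner-≢ {a = a} b

    inj : Injective _≡_ _≡_ point
    inj {a@(_ , x∈e) , b@((_ , y∈e) , _)} {a′@(_ , x∈e′) , ((_ , y∈e′) , _)} eq with cong proj₁ eq
    ... | refl with pencil-≡ {a = a} {a′} (block-unique (partner-≢ {a = a} b) x∈e y∈e x∈e′ y∈e′)
    ... | refl = cong (a ,_) (partners-≡ {a = a} refl)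

    surj : StrictlySurjective _≡_ point
    surj (y , x≢y) with pairs x y x≢y
    ... | e , (x∈e , y∈e) , _ = ((e , x∈e) , (y , y∈e) , x≢y ∘ cong proj₁) , refl

  -- Column `x` of the incidence matrix whose rows are the blocks. As a `Subset` it has a
  -- cardinality, which names the degree of `x` before its value is known.
  blocksThrough : Fin N → Subset size
  blocksThrough x = tabulate λ e → lookup (edge e) x

  pencil↔members : ∀ x → Pencil x ↔ Members (blocksThrough x)
  pencil↔members x = mk↔ₛ′
    (λ { (e , x∈e) → e , lookup⇒[]= e _ (trans (lookup∘tabulate _ e) ([]=⇒lookup x∈e)) })
    (λ { (e , e∈) → e , lookup⇒[]= x _ (trans (sym (lookup∘tabulate _ e)) ([]=⇒lookup e∈)) })
    (λ _ → members-≡ refl)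
    (λ _ → pencil-≡ refl)

  -- Each block through `x` has `m` further points, and together these are all points other than
  -- `x`; so the degree times `m` is `n * m`, and `m` cancels.
  pencil↔Fin : ∀ {n} .{{_ : NonZero m}} → N ≡ 1 + n * m → (x : Fin N) → Pencil x ↔ Fin n
  pencil↔Fin {n} refl x = subst (λ c → Pencil x ↔ Fin c) degree≡n pencil↔degree
    where
    degree = ∣ blocksThrough x ∣

    pencil↔degree : Pencil x ↔ Fin degree
    pencil↔degree = members↔Fin (blocksThrough x) ↔-∘ pencil↔members x

    flags↔Fin : (∃ λ (a : Pencil x) → Partners a) ↔ Fin (degree * m)
    flags↔Fin = ↔-sym Fin.*↔× ↔-∘ Σ-↔ pencil↔degree (partners↔Fin _)

    degree≡n : degree ≡ n
    degree≡n = *-cancelʳ-≡ degree n m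
      -- Matching on `refl` has made `N` equal to `suc (n * m)`, so `n * m` points remain once `x`
      -- is removed.
      (↔⇒≡ (others↔Fin (↔-id _) x ↔-∘ (flags↔others x ↔-∘ ↔-sym flags↔Fin)))

  -- The link of a vertex of `Γ`.

  module _ (G : FiniteGraph) (ε : Enumeration hypergraph (FiniteGraph.order G)) where

    open FiniteGraph G using (V; Adj; adj?; labelling)

    private
      Γ′ = FiniteGraph.graph (Γ G hypergraph ε)

    blocks : ∀ y → V ↔ Pencil y
    blocks y = ε y ↔-∘ labelling

    -- `f G hypergraph ε e (y , w)` unfolds to `block y w ≡ e`, so every vertex lies in exactly one
    -- clique.
    block : Fin N → V → Edge
    block y w = proj₁ (Inverse.to (blocks y) w)

    ∈-block : ∀ y w → y ∈ edge (block y w)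
    ∈-block y w = proj₂ (Inverse.to (blocks y) w)

    block-injective : ∀ y → Injective _≡_ _≡_ (block y)
    block-injective y eq = to-injective (blocks y) (pencil-≡ eq)

    corner : ∀ {y} → Pencil y → V
    corner {y} = Inverse.from (blocks y)

    block-corner : ∀ {y} (a : Pencil y) → block y (corner a) ≡ proj₁ a
    block-corner {y} a = cong proj₁ (Inverse.strictlyInverseˡ (blocks y) a)

    -- By `block-injective` a clique meets each copy of `G` in at most one vertex, so clique edges
    -- and copy edges never coincide.
    clique-≢ : ∀ {y w y′ z} → CliqueAdj G hypergraph ε (y , w) (y′ , z) → y ≢ y′
    clique-≢ {y} (≢ , _ , p , q) refl = ≢ (cong (y ,_) (block-injective y (trans p (sym q))))

    module _ (x : Fin N) (u : V) where

      pencil : Pencil x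
      pencil = Inverse.to (blocks x) u

      e₀ : Edge
      e₀ = block x u

      cliqueVertex : Partners pencil → Fin N × V
      cliqueVertex ((y , y∈e) , _) = y , corner (e₀ , y∈e)

      cliqueVertex-∈ : ∀ b → f G hypergraph ε e₀ (cliqueVertex b)
      cliqueVertex-∈ ((_ , y∈e) , _) = block-corner (e₀ , y∈e)

      cliqueVertex-adj : ∀ b → CliqueAdj G hypergraph ε (x , u) (cliqueVertex b)
      cliqueVertex-adj b = partner-≢ {a = pencil} b ∘ cong proj₁ , e₀ , refl , cliqueVertex-∈ b

      part : Fin m → Partners pencil
      part = Inverse.from (partners↔Fin pencil)

      part-injective : Injective _≡_ _≡_ part
      part-injective = to-injective (↔-sym (partners↔Fin pencil))

      cliquePart-injective : ∀ {j l} → proj₁ (cliqueVertex (part j)) ≡ proj₁ (cliqueVertex (part l)) → j ≡ l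
      cliquePart-injective eq = part-injective (partners-≡ {a = pencil} eq)

      Parts : Graph
      Parts = FiniteGraph.graph (K m) ⊕ link (FiniteGraph.graph G) u

      embed : Graph.V Parts → Graph.V (link Γ′ (x , u))
      embed (inj₁ j)           = cliqueVertex (part j) , [ inj₂ (cliqueVertex-adj (part j)) ]
      embed (inj₂ (w , [ p ])) = (x , w) , [ inj₁ (refl , p) ]

      embed-injective : Injective _≡_ _≡_ embed
      embed-injective {inj₁ j} {inj₁ l} eq = cong inj₁ (cliquePart-injective (cong (proj₁ ∘ value) eq))
      embed-injective {inj₁ j} {inj₂ _} eq =
        contradiction (sym (cong (proj₁ ∘ value) eq)) (partner-≢ {a = pencil} (part j))
      embed-injective {inj₂ _} {inj₁ l} eq =
        contradiction (cong (proj₁ ∘ value) eq) (partner-≢ {a = pencil} (part l))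
      embed-injective {inj₂ _} {inj₂ _} eq = cong inj₂ (value-injective (cong (proj₂ ∘ value) eq))

      embed-surjective : StrictlySurjective _≡_ embed
      embed-surjective ((y , w) , [ p ]) with recompute (Graph.adj? Γ′ (x , u) (y , w)) p
      ... | inj₁ (refl , a) = inj₂ (w , [ a ]) , refl
      -- The `refl` identifies the block of the clique edge with `e₀`. Then `(y , w)` and
      -- `cliqueVertex b` are both the vertex of `f e₀` in the copy at `y`.
      ... | inj₂ c@(_ , _ , refl , q) =
        inj₁ (Inverse.to (partners↔Fin pencil) b) ,
        value-injective (trans (cong cliqueVertex (Inverse.strictlyInverseʳ (partners↔Fin pencil) b))
          (cong (y ,_) (block-injective y (trans (cliqueVertex-∈ b) (sym q)))))
        where
        b : Partners pencil
        b = (y , subst (λ e → y ∈ edge e) q (∈-block y w)) , clique-≢ c ∘ cong proj₁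

      -- A copy edge would force equal points. A clique edge lies in the only clique of
      -- `cliqueVertex b`, that of `e₀`; this clique meets the copy at `x` only in `u`, so `w` would
      -- equal `u` and `Adj u w` would be a loop.
      part-≁-copy : ∀ b {w} → Adj u w → ¬ Graph.Adj Γ′ (x , w) (cliqueVertex b)
      part-≁-copy b a (inj₁ (x≡y , _)) = partner-≢ {a = pencil} b x≡y
      part-≁-copy b a (inj₂ (_ , e , p , q)) =
        FiniteGraph.irrefl G (block-injective x (sym (trans p (sym e₀≡e)))) a
        where
        e₀≡e : e₀ ≡ e
        e₀≡e = trans (sym (cliqueVertex-∈ b)) q

      embed-preserves : ∀ a b → Graph.Adj Parts a b ⇔ Graph.Adj (link Γ′ (x , u)) (embed a) (embed b)
      embed-preserves (inj₁ j) (inj₁ l) = mk⇔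
        (λ j≢l → inj₂ (j≢l ∘ cliquePart-injective ∘ cong proj₁ , e₀ ,
                        cliqueVertex-∈ (part j) , cliqueVertex-∈ (part l)))
        (λ { a refl → Graph.irrefl Γ′ refl a })
      embed-preserves (inj₂ _) (inj₂ _) = mk⇔
        (λ a → inj₁ (refl , a))
        -- Both vertices lie in the copy at `x`, which excludes a clique edge.
        [ proj₂ , (λ c → contradiction refl (clique-≢ c)) ]′
      embed-preserves (inj₁ j) (inj₂ (w , [ p ])) = mk⇔ (λ ())
        (λ a → part-≁-copy (part j) (recompute (adj? u w) p) (Graph.symm Γ′ a))
      embed-preserves (inj₂ (w , [ p ])) (inj₁ j) = mk⇔ (λ ())
        (part-≁-copy (part j) (recompute (adj? u w) p))

      link-Γ : Parts ≅ link Γ′ (x , u)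
      link-Γ = record
        { bijection = bijective⇒↔ {f = embed} embed-injective embed-surjective
        ; preserves = embed-preserves
        }

    constantLink-Γ : ∀ s → ConstantLink G (s · K m) → ConstantLink (Γ G hypergraph ε) (suc s · K m)
    constantLink-Γ s G-link (x , u) =
      ≅-sym (≅-trans (suc-·-≅ s (K m)) (≅-trans (⊕-congˡ (≅-sym (G-link u))) (link-Γ x u)))

theorem14 : (k q t : ℕ) → 3 ≤ k → 1 ≤ q → 1 ≤ t →
    (v n : ℕ → ℕ) →
    (H : ∀ i → 1 ≤ i → i < t → SteinerSystem k (v i)) →
    (∀ i → 1 ≤ i → i < t → v i ≡ 1 + n i * (k ∸ 1)) →
    (1 < t → n 1 ≡ q * k) →
    (∀ j → 2 ≤ j → j < t → n j ≡ q * k * ∏ (j ∸ 1) v) →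
    (∃ λ G → IsS q H t G) ×
    (∀ G → IsS q H t G →
    FiniteGraph.order G ≡ k * q * ∏ (t ∸ 1) v ×
    ConstantLink G (t · K (k ∸ 1)))
-- The pattern reduces `k ∸ 1` to `m` and exposes `m` as a successor, which yields the `NonZero m`
-- needed to cancel in `pencil↔Fin`.
theorem14 (suc m@(suc _)) q t (s≤s _) _ 1≤t v n H v≡ n₁≡ nⱼ≡ =
  S-exists t 1≤t ≤-refl ,
  λ G S → trans (S-order S) (cong (_* ∏ (t ∸ 1) v) (*-comm q (suc m))) , S-link S
  where
  S-order : ∀ {i G} → IsS q H i G → FiniteGraph.order G ≡ q * suc m * ∏ (i ∸ 1) v
  S-order first = sym (*-identityʳ _)
  S-order (next {suc j} {G} _ _ S ε) = begin
    v (suc j) * FiniteGraph.order G       ≡⟨ cong (v (suc j) *_) (S-order S) ⟩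
    v (suc j) * (q * suc m * ∏ j v)       ≡⟨ *-comm (v (suc j)) _ ⟩
    q * suc m * ∏ j v * v (suc j)         ≡⟨ *-assoc (q * suc m) (∏ j v) _ ⟩
    q * suc m * (∏ j v * v (suc j))       ∎
    where open ≡-Reasoning

  S-link : ∀ {i G} → IsS q H i G → ConstantLink G (i · K m)
  S-link first = link-qK q m
  S-link (next {i} {G} 1≤i i<t S ε) = constantLink-Γ (H i 1≤i i<t) G ε i (S-link S)

  -- Merges the two hypotheses on `n`: the one on `n 1` is the general formula with an empty
  -- product.
  n≡ : ∀ i → 1 ≤ i → i < t → n i ≡ q * suc m * ∏ (i ∸ 1) v
  n≡ 1             _ 1<t = trans (n₁≡ 1<t) (sym (*-identityʳ _))
  n≡ (suc (suc j)) _ j<t = nⱼ≡ (suc (suc j)) (s≤s (s≤s z≤n)) j<t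

  S-exists : ∀ i → 1 ≤ i → i ≤ t → ∃ λ G → IsS q H i G
  S-exists 1             _ _   = _ , first
  -- The bound `suc (suc j) ≤ t` is by definition `suc j < t`, which is what `H (suc j)` asks for.
  S-exists (suc (suc j)) _ i<t with S-exists (suc j) (s≤s z≤n) (<⇒≤ i<t)
  ... | G , S = _ , next (s≤s z≤n) i<t S λ x →
    -- The degree `n (suc j)` of the Steiner system is replaced by the order of `G`, as
    -- `Enumeration` demands.
    subst (λ d → Fin d ↔ _) (trans (n≡ (suc j) (s≤s z≤n) i<t) (sym (S-order S)))
      (↔-sym (pencil↔Fin (H (suc j) (s≤s z≤n) i<t) (v≡ (suc j) (s≤s z≤n) i<t) x))
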